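{- If $G$ is a square-chordal graph, then its injective hull $\mathcal{H}(G)$ is square-chordal.
   Context: Graphs are finite, connected, simple, with shortest-path metric $d_G$. The $k$-th power $G^k$ has vertex set $V(G)$ with distinct $u,v$ adjacent iff $d_G(u,v)\le k$. A graph is chordal if it has no induced cycle of length at least 4, and $G$ is square-chordal if $G^2$ is chordal. A graph is Helly if every family of pairwise intersecting disks $D(v,r)=\{u:d(u,v)\le r\}$ has a common vertex. The injective hull $\mathcal{H}(G)$ is the unique minimal Helly graph containing $G$ as an isometric subgraph (equivalently, the graph on functions $f:V(G)\to\mathbb{Z}_{\ge0}$ with $f(x)+f(y)\ge d_G(x,y)$ for all $x,y$ and for each $x$ some $y$ with equality, adjacency meaning sup-norm distance 1). -}

module Defs where

open import Level using (0ℓ)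
open import Data.Nat using (ℕ; zero; suc; _+_; _≤_; _<_; ∣_-_∣)
open import Data.Fin using (Fin; toℕ)
open import Data.Product using (Σ; ∃; _×_; _,_)
open import Data.Sum using (_⊎_)
open import Relation.Nullary using (¬_)
open import Relation.Binary.PropositionalEquality using (_≡_; _≢_)

-- A graph presented by a vertex type, a vertex equality (equivalence) and
-- an adjacency relation.  Used for the generic notions (walk-distance,
-- powers, chordality); vertex distinctness is measured by _≈_.
record RawGraph : Set₁ where
  field
    V    : Set
    _≈_  : V → V → Set
    Adj  : V → V → Set

open RawGraph public

-- Reach G k u v  :  d_G(u,v) ≤ k  (there is a walk of length ≤ k from u to v).
Reach : (G : RawGraph) → ℕ → V G → V G → Set
Reach G zero    u v = _≈_ G u v
Reach G (suc k) u v = Reach G k u v ⊎ Σ (V G) (λ w → Reach G k u w × Adj G w v)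

IsDist : (G : RawGraph) → V G → V G → ℕ → Set
IsDist G u v k = Reach G k u v × (∀ j → j < k → ¬ Reach G j u v)

Power : RawGraph → ℕ → RawGraph
Power G k = record
  { V   = V G
  ; _≈_ = _≈_ G
  ; Adj = λ u v → ¬ (_≈_ G u v) × Reach G k u v
  }

CycNbr : (m : ℕ) → Fin m → Fin m → Set
CycNbr m i j =
    suc (toℕ i) ≡ toℕ j
  ⊎ suc (toℕ j) ≡ toℕ i
  ⊎ (toℕ i ≡ 0 × suc (toℕ j) ≡ m)
  ⊎ (toℕ j ≡ 0 × suc (toℕ i) ≡ m)

InducedCycle : (G : RawGraph) → (m : ℕ) → (Fin m → V G) → Set
InducedCycle G m c =
    (∀ i j → i ≢ j → ¬ (_≈_ G (c i) (c j)))
  × (∀ i j → CycNbr m i j → Adj G (c i) (c j))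
  × (∀ i j → i ≢ j → ¬ CycNbr m i j → ¬ Adj G (c i) (c j))

Chordal : RawGraph → Set
Chordal G = ∀ m → 4 ≤ m → (c : Fin m → V G) → ¬ InducedCycle G m c

SquareChordal : RawGraph → Set
SquareChordal G = Chordal (Power G 2)

record SimpleGraph (n : ℕ) : Set₁ where
  field
    adj      : Fin n → Fin n → Set
    adj-sym  : ∀ {u v} → adj u v → adj v u
    adj-irr  : ∀ {u} → ¬ adj u u

open SimpleGraph public

raw : ∀ {n} → SimpleGraph n → RawGraph
raw {n} G = record { V = Fin n ; _≈_ = _≡_ ; Adj = adj G }

Connected : ∀ {n} → SimpleGraph n → Set
Connected G = ∀ u v → ∃ λ k → Reach (raw G) k u v

IsHullVertex : ∀ {n} → SimpleGraph n → (Fin n → ℕ) → Set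
IsHullVertex G f =
    (∀ x y → Reach (raw G) (f x + f y) x y)
  × (∀ x → ∃ λ y → IsDist (raw G) x y (f x + f y))

Hull : ∀ {n} → SimpleGraph n → RawGraph
Hull {n} G = record
  { V   = Σ (Fin n → ℕ) (IsHullVertex G)
  ; _≈_ = λ { (f , _) (g , _) → ∀ x → f x ≡ g x }
  ; Adj = λ { (f , _) (g , _) →
              (∀ x → ∣ f x - g x ∣ ≤ 1) × ∃ (λ x → ∣ f x - g x ∣ ≡ 1) }
  }

-- Call two vertex sets touching if they contain vertices at distance at most 2. Hull vertices f
-- and g are within distance 2 exactly when the disks D(x, f x) and D(y, g y) touch for all x and y:
-- if they all do, a minimal hull function below min(f, g) + 1 is a midpoint of f and g.
-- Let f₀, f₁, f₂, … be an induced cycle of the squared hull. Pick disks P of f₀ and Q of f₂ that do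
-- not touch, and let X be the component of Q in G² once the vertices touching P are removed. The
-- set S of vertices next to X that touch P is a clique of G², and every disk of f₁ meets S, since
-- it touches both P and Q. For j ≥ 3 some disk Z of fⱼ fails to touch a disk of f₁, so Z misses S.
-- Inductively along the cycle these disks stay inside X, but the last one touches P.
module Submission where

open import Defs
open import Data.Empty using (⊥; ⊥-elim)
open import Data.Fin using (Fin; zero; suc; toℕ; inject₁; fromℕ)
open import Data.Fin.Induction using (<-weakInduction)
open import Data.Fin.Properties using (_≟_; any?; all?; ¬∀⟶∃¬; sequence; toℕ-injective; toℕ-inject₁; toℕ-fromℕ)
open import Data.List using (List; []; _∷_; length; lookup; allFin)
open import Data.List.Membership.Propositional.Properties using (∈-allFin; ∈-lookup)
open import Data.List.Relation.Unary.All as All using (All; []; _∷_)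
open import Data.Nat using (ℕ; zero; suc; pred; _+_; _⊓_; _≤_; _<_; _≤′_; ≤′-refl; ≤′-step; ∣_-_∣; z≤n; s≤s)
open import Data.Nat.Properties renaming (_≟_ to _≟ℕ_)
open import Data.Product using (∃; ∃-syntax; _×_; _,_; proj₁; proj₂)
open import Data.Sum using (_⊎_; inj₁; inj₂)
open import Data.Vec.Functional using (updateAt)
open import Data.Vec.Functional.Properties using (updateAt-updates; updateAt-minimal)
open import Effect.Monad using (RawMonad)
open import Relation.Binary.Construct.Closure.ReflexiveTransitive using (Star; ε; _◅_; _◅◅_; map; reverse)
open import Relation.Binary.Definitions using (DecidableEquality; tri<; tri≈; tri>)
open import Relation.Binary.PropositionalEquality using (_≡_; _≢_; refl; sym; trans; cong; cong₂; subst; ≢-sym)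
open import Relation.Nullary using (¬_; Dec; yes; no)
open import Relation.Nullary.Decidable using (_⊎-dec_; _×-dec_; ¬¬-excluded-middle)
open import Relation.Nullary.Negation using (¬¬-Monad)

-- Cyclic adjacency of indices, read for pairs in increasing order

Consecutive : (m : ℕ) → Fin m → Fin m → Set
Consecutive m i j = suc (toℕ i) ≡ toℕ j ⊎ (toℕ i ≡ 0 × suc (toℕ j) ≡ m)

consecutive⇒CycNbr : ∀ {m i j} → Consecutive m i j → CycNbr m i j
consecutive⇒CycNbr (inj₁ e) = inj₁ e
consecutive⇒CycNbr (inj₂ e) = inj₂ (inj₂ (inj₁ e))

CycNbr-sym : ∀ {m i j} → CycNbr m i j → CycNbr m j i
CycNbr-sym (inj₁ e)               = inj₂ (inj₁ e)
CycNbr-sym (inj₂ (inj₁ e))        = inj₁ e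
CycNbr-sym (inj₂ (inj₂ (inj₁ e))) = inj₂ (inj₂ (inj₂ e))
CycNbr-sym (inj₂ (inj₂ (inj₂ e))) = inj₂ (inj₂ (inj₁ e))

CycNbr⇒consecutive : ∀ {m} {i j : Fin m} → 2 < m → toℕ i < toℕ j → CycNbr m i j → Consecutive m i j
CycNbr⇒consecutive _   _   (inj₁ e)               = inj₁ e
CycNbr⇒consecutive _   i<j (inj₂ (inj₁ e))        = ⊥-elim (<-asym i<j (subst (_ <_) e ≤-refl))
CycNbr⇒consecutive _   _   (inj₂ (inj₂ (inj₁ e))) = inj₂ e
CycNbr⇒consecutive _   i<j (inj₂ (inj₂ (inj₂ (e , _)))) with () ← subst (_ <_) e i<j

-- Induced paths and cycles for a reflexive touching relation

module Touching
  {V : Set} (_≟ⱽ_ : DecidableEquality V) (T : V → V → Set)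
  (T? : ∀ u v → Dec (T u v)) (T-refl : ∀ {v} → T v v) (T-sym : ∀ {u v} → T u v → T v u)
  where

  -- With `T` taken as distance at most 2, this is definitionally the squared graph.
  graph : RawGraph
  graph = record { V = V ; _≈_ = _≡_ ; Adj = λ u v → ¬ (u ≡ v) × T u v }

  ¬T⇒≢ : ∀ {u v} → ¬ T u v → u ≢ v
  ¬T⇒≢ ¬t refl = ¬t T-refl

  Within : (V → Set) → V → V → Set
  Within Q u v = T u v × Q u × Q v

  within-sym : ∀ {Q u v} → Star (Within Q) u v → Star (Within Q) v u
  within-sym = reverse (λ (t , q , q′) → T-sym t , q′ , q)

  -- Arc s x xs: the list x ∷ xs is an induced path whose last vertex is its only one touching s.
  data Arc (s : V) : V → List V → Set where
    last : ∀ {x} → T x s → x ≢ s → Arc s x []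
    step : ∀ {x y ys} → ¬ T x s → x ≢ y → T x y → All (λ z → ¬ T x z) ys → Arc s y ys → Arc s x (y ∷ ys)

  LastTouch : (Q : V → Set) (s v : V) → Set
  LastTouch Q s v = ∃[ y ] ∃[ ys ] Arc s y ys × T v y × All (λ z → ¬ T v z) ys × All Q (y ∷ ys)

  last-touch : ∀ {Q s x xs} v → Arc s x xs → All Q (x ∷ xs) → LastTouch Q s v ⊎ All (λ z → ¬ T v z) (x ∷ xs)
  last-touch {x = x} v a@(last _ _) q with T? v x
  ... | yes t = inj₁ (_ , _ , a , t , [] , q)
  ... | no ¬t = inj₂ (¬t ∷ [])
  last-touch {x = x} v a@(step _ _ _ _ a′) q@(_ ∷ q′) with last-touch v a′ q′
  ... | inj₁ r = inj₁ r
  ... | inj₂ none with T? v x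
  ...   | yes t = inj₁ (_ , _ , a , t , none , q)
  ...   | no ¬t = inj₂ (¬t ∷ none)

  last-touch′ : ∀ {Q s x xs v} → T v x → Arc s x xs → All Q (x ∷ xs) → LastTouch Q s v
  last-touch′ {v = v} t a q with last-touch v a q
  ... | inj₁ r = r
  ... | inj₂ (¬t ∷ _) = ⊥-elim (¬t t)

  -- Cutting at the last vertex touched leaves `v` touching only the head of the remaining arc, so
  -- the extension stays induced. If `v` is that head, nothing is added.
  prepend : ∀ {Q s y ys v} → Arc s y ys → All Q (y ∷ ys) → T v y → ¬ T v s → Q v →
            ∃[ zs ] Arc s v zs × All Q (v ∷ zs)
  prepend {v = v} a q t ¬t qv with last-touch′ t a q
  ... | y , ys , a′ , t′ , none , q′ with v ≟ⱽ y
  ...   | yes refl = ys , a′ , q′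
  ...   | no v≢y   = y ∷ ys , step ¬t v≢y t′ none a′ , qv ∷ q′

  lookup-none : ∀ {x xs} → All (λ z → ¬ T x z) xs → ∀ i → ¬ T x (lookup xs i)
  lookup-none none i = All.lookup none (∈-lookup i)

  arc-path : ∀ {s x xs} → Arc s x xs → ∀ i j → toℕ i < toℕ j →
             let u = lookup (x ∷ xs) i ; v = lookup (x ∷ xs) j in
             u ≢ v × (suc (toℕ i) ≡ toℕ j → T u v) × (suc (toℕ i) ≢ toℕ j → ¬ T u v)
  arc-path (last _ _) zero zero ()
  arc-path (step _ x≢y t none a) zero (suc zero) _ = x≢y , (λ _ → t) , λ ne → ⊥-elim (ne refl)
  arc-path (step _ x≢y t none a) zero (suc (suc j)) _ =
    ¬T⇒≢ (lookup-none none j) , (λ ()) , λ _ → lookup-none none j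
  arc-path (step _ _ _ _ a) (suc i) (suc j) (s≤s i<j) =
    let d , t , n = arc-path a i j i<j in d , (λ e → t (suc-injective e)) , λ ne → n (λ e → ne (cong suc e))

  arc-closing : ∀ {s x xs} → Arc s x xs → ∀ i →
                let u = lookup (x ∷ xs) i in
                s ≢ u × (toℕ i ≡ length xs → T s u) × (toℕ i ≢ length xs → ¬ T s u)
  arc-closing (last t x≢s) zero = ≢-sym x≢s , (λ _ → T-sym t) , λ ne → ⊥-elim (ne refl)
  arc-closing (step ¬t _ _ _ _) zero = ≢-sym (¬T⇒≢ ¬t) , (λ ()) , λ _ t → ¬t (T-sym t)
  arc-closing (step _ _ _ _ a) (suc i) =
    let d , t , n = arc-closing a i in d , (λ e → t (suc-injective e)) , λ ne → n (λ e → ne (cong suc e))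

  -- On the arc, `v` touches only the head and `s` only the last vertex, so `s` and `v` close it up
  -- without chords.
  arc-cycle : ∀ {s v y ys} → T v s → v ≢ s → v ≢ y → T v y → All (λ z → ¬ T v z) ys → Arc s y ys →
              InducedCycle graph (3 + length ys) (lookup (s ∷ v ∷ y ∷ ys))
  arc-cycle {s} {v} {y} {ys} ts v≢s v≢y ty none a = distinct , adjacent , nonadjacent
    where
    m : ℕ
    m = 3 + length ys

    c : Fin m → V
    c = lookup (s ∷ v ∷ y ∷ ys)

    ordered : ∀ i j → toℕ i < toℕ j →
              c i ≢ c j × (Consecutive m i j → T (c i) (c j)) × (¬ Consecutive m i j → ¬ T (c i) (c j))
    ordered zero zero ()
    ordered zero (suc zero) _ = ≢-sym v≢s , (λ _ → T-sym ts) , λ ne → ⊥-elim (ne (inj₁ refl))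
    ordered zero (suc (suc j)) _ =
      let d , t , n = arc-closing a j in
      d , (λ { (inj₂ (_ , e)) → t (suc-injective (suc-injective (suc-injective e))) }) ,
      λ ne → n (λ e → ne (inj₂ (refl , cong (3 +_) e)))
    ordered (suc zero) (suc zero) (s≤s ())
    ordered (suc zero) (suc (suc zero)) _ = v≢y , (λ _ → ty) , λ ne → ⊥-elim (ne (inj₁ refl))
    ordered (suc zero) (suc (suc (suc j))) _ =
      ¬T⇒≢ (lookup-none none j) , (λ { (inj₁ ()) ; (inj₂ ()) }) , λ _ → lookup-none none j
    ordered (suc (suc i)) (suc zero) (s≤s ())
    ordered (suc (suc i)) (suc (suc j)) (s≤s (s≤s i<j)) =
      let d , t , n = arc-path a i j i<j in
      d , (λ { (inj₁ e) → t (suc-injective (suc-injective e)) ; (inj₂ ()) }) ,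
      λ ne → n (λ e → ne (inj₁ (cong (2 +_) e)))

    2<m : 2 < m
    2<m = s≤s (s≤s (s≤s z≤n))

    distinct : ∀ i j → i ≢ j → c i ≢ c j
    distinct i j i≢j with <-cmp (toℕ i) (toℕ j)
    ... | tri< i<j _ _ = proj₁ (ordered i j i<j)
    ... | tri≈ _ e _   = ⊥-elim (i≢j (toℕ-injective e))
    ... | tri> _ _ j<i = ≢-sym (proj₁ (ordered j i j<i))

    not-reflexive : ∀ i → ¬ CycNbr m i i
    not-reflexive i (inj₁ e) = <-irrefl (sym e) ≤-refl
    not-reflexive i (inj₂ (inj₁ e)) = <-irrefl (sym e) ≤-refl
    not-reflexive zero (inj₂ (inj₂ (inj₁ (_ , ()))))
    not-reflexive zero (inj₂ (inj₂ (inj₂ (_ , ()))))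

    adjacent : ∀ i j → CycNbr m i j → ¬ (c i ≡ c j) × T (c i) (c j)
    adjacent i j nb with <-cmp (toℕ i) (toℕ j)
    ... | tri< i<j _ _ = let d , t , _ = ordered i j i<j in
      d , t (CycNbr⇒consecutive 2<m i<j nb)
    ... | tri≈ _ e _   = ⊥-elim (not-reflexive i (subst (CycNbr m i) (sym (toℕ-injective e)) nb))
    ... | tri> _ _ j<i = let d , t , _ = ordered j i j<i in
      ≢-sym d , T-sym (t (CycNbr⇒consecutive 2<m j<i (CycNbr-sym nb)))

    nonadjacent : ∀ i j → i ≢ j → ¬ CycNbr m i j → ¬ (¬ (c i ≡ c j) × T (c i) (c j))
    nonadjacent i j i≢j ¬nb (_ , t) with <-cmp (toℕ i) (toℕ j)
    ... | tri< i<j _ _ = proj₂ (proj₂ (ordered i j i<j)) (λ e → ¬nb (consecutive⇒CycNbr e)) t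
    ... | tri≈ _ e _   = i≢j (toℕ-injective e)
    ... | tri> _ _ j<i =
      proj₂ (proj₂ (ordered j i j<i)) (λ e → ¬nb (CycNbr-sym (consecutive⇒CycNbr e))) (T-sym t)

  -- Separators of chordal graphs

  Avoids : (V → Set) → V → Set
  Avoids P v = ∀ {p} → P p → ¬ T v p

  module _ (chordal : Chordal graph) {P : V → Set} where

    module _ {s} (s∉P : ¬ P s) where

      -- Imposed on an arc, this forces its last vertex into P.
      Good : V → Set
      Good z = T z s → P z

      arc-within : ∀ {u v} → Star (Within P) u v → ∃[ ys ] Arc s u ys × All Good (u ∷ ys) →
                   ∃[ ys ] Arc s v ys × All Good (v ∷ ys)
      arc-within ε r = r
      arc-within (_◅_ {j = w} (t , _ , w∈P) path) (_ , a , q) with T? w s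
      -- Only the last vertex of an arc may touch `s`, so here the arc restarts.
      ... | yes ts = arc-within path ([] , last ts (λ { refl → s∉P w∈P }) , (λ _ → w∈P) ∷ [])
      ... | no ¬ts = arc-within path (prepend a q (T-sym t) ¬ts (λ _ → w∈P))

      -- `v` advances along the path towards `x`. While it does not touch `s` it joins the arc,
      -- where `Good` holds vacuously; it touches `s` at `x` at the latest.
      no-return : ∀ {p v x y ys} → P p → T p s → Star (Within (Avoids P)) v x → T x s → Avoids P v →
                  T v y → Arc s y ys → All Good (y ∷ ys) → ⊥
      no-return {v = v} p∈P tp path tx av t a q with last-touch′ t a q
      ... | y , ys , a′ , t′ , none , q′@(g ∷ _) with T? v s
      ...   | yes ts with a′
      -- The single vertex `y` touches `s`, so `Good` puts it in `P`, which `v` avoids.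
      ...     | last ty _ = av (g ty) t′
      -- The remaining arc has at least two vertices; with `s` and `v` the cycle has length at least
      -- 4.
      ...     | step _ _ _ _ _ =
        chordal _ (s≤s (s≤s (s≤s (s≤s z≤n)))) _
          (arc-cycle ts (λ { refl → av p∈P (T-sym tp) }) (λ { refl → av (g ts) T-refl }) t′ none a′)
      no-return p∈P tp ε tx av t a q | _ | no ¬ts = ¬ts tx
      no-return p∈P tp ((tvw , _ , aw) ◅ path) tx av t a q | _ | no ¬ts =
        let _ , a″ , q″ = prepend a q t ¬ts (λ ts → ⊥-elim (¬ts ts)) in
        no-return p∈P tp path tx aw (T-sym tvw) a″ q″

    -- Dirac's argument: if s and t did not touch, induced s–t paths through P and through a
    -- component avoiding N[P] would close up to an induced cycle.
    separator-clique : ∀ {s t p₁ p₂ x₁ x₂} →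
      P p₁ → T p₁ s → T t p₂ → Star (Within P) p₁ p₂ →
      Avoids P x₁ → T x₁ s → Avoids P x₂ → T x₂ t → Star (Within (Avoids P)) x₂ x₁ → T t s
    separator-clique {s} {t} {p₁} p∈P ps tp pathP ax₁ xs ax₂ xt pathX with T? t s
    ... | yes ts = ts
    ... | no ¬ts =
      let s∉P = λ s∈P → ax₁ s∈P xs
          _ , a , q = arc-within s∉P pathP ([] , last ps (λ { refl → s∉P p∈P }) , (λ _ → p∈P) ∷ [])
          _ , a′ , q′ = prepend a q tp ¬ts (λ ts → ⊥-elim (¬ts ts))
      in ⊥-elim (no-return s∉P p∈P ps pathX xs ax₂ xt a′ q′)

  -- Chains of connected sets that touch

  ConnectedSet : (V → Set) → Set
  ConnectedSet B = ∀ {u v} → B u → B v → Star (Within B) u v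

  Touches : (V → Set) → (V → Set) → Set
  Touches B C = ∃[ u ] ∃[ v ] B u × C v × T u v

  touches-sym : ∀ {B C} → Touches B C → Touches C B
  touches-sym (u , v , b , c , t) = v , u , c , b , T-sym t

  -- In the cycle of length `4 + k`, `P` is a disk of f₀, each `Y i` one of f₁, and `Z i` one of the
  -- vertex with index i + 2. `Y` is a family because each later vertex may miss a different disk of
  -- f₁.
  no-touching-chain : Chordal graph → ∀ {k} {P : V → Set} {Y : Fin (suc k) → V → Set} {Z : Fin (2 + k) → V → Set} →
    (∀ v → Dec (∃[ p ] P p × T v p)) →
    ConnectedSet P → (∀ i → ConnectedSet (Y i)) → (∀ i → ConnectedSet (Z i)) →
    ¬ Touches (Z zero) P →
    (∀ i → Touches (Y i) P) → (∀ i → Touches (Z zero) (Y i)) → (∀ i → ¬ Touches (Y i) (Z (suc i))) →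
    (∀ i → Touches (Z (inject₁ i)) (Z (suc i))) → ¬ Touches (Z (fromℕ (suc k))) P
  no-touching-chain chordal {k} {P} {Y} {Z} touchP? connP connY connZ Z₀¬P Y-P Z₀-Y Y¬Z Z-Z =
    λ { (u , p , z , p∈P , t) → avoids (<-weakInduction Z⊆X base next (fromℕ (suc k)) z) p∈P t }
    where
    b : V
    b = proj₁ (Z₀-Y zero)

    b∈Z₀ : Z zero b
    b∈Z₀ = proj₁ (proj₂ (proj₂ (Z₀-Y zero)))

    Z₀-avoids : ∀ {v} → Z zero v → Avoids P v
    Z₀-avoids z p∈P t = Z₀¬P (_ , _ , z , p∈P , t)

    X : V → Set
    X v = Star (Within (Avoids P)) b v

    avoids : ∀ {v} → X v → Avoids P v
    -- An empty path carries no proof of avoidance; it comes from `b` lying in `Z zero`.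
    avoids ε = Z₀-avoids b∈Z₀
    avoids ((_ , _ , a) ◅ path) = go a path
      where
      go : ∀ {u v} → Avoids P u → Star (Within (Avoids P)) u v → Avoids P v
      go a ε = a
      go _ ((_ , _ , a) ◅ path) = go a path

    Separator : V → Set
    Separator v = (∃[ p ] P p × T v p) × ∃[ x ] X x × T x v

    -- The two vertices are linked through `P` by its connectedness and through `X` by way of `b`.
    separator-touch : ∀ {u v} → Separator u → Separator v → T u v
    separator-touch ((p , p∈P , up) , x , Xx , xu) ((q , q∈P , vq) , y , Xy , yv) =
      separator-clique chordal q∈P (T-sym vq) up (connP q∈P p∈P) (avoids Xy) yv (avoids Xx) xu
        (within-sym Xx ◅◅ Xy)

    -- The first vertex of the path that touches `P` is a separator vertex, since it also touches
    -- `X`; all vertices before it join `X`.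
    spread : ∀ {B : V → Set} {x u v} → X x → T x u → B u → Star (Within B) u v → X v ⊎ ∃[ w ] B w × Separator w
    spread {u = u} Xx t Bu path with touchP? u
    ... | yes touch = inj₂ (u , Bu , touch , _ , Xx , t)
    ... | no ¬touch with Xx ◅◅ ((t , avoids Xx , λ p∈P t → ¬touch (_ , p∈P , t)) ◅ ε)
    ...   | Xu with path
    ...     | ε = inj₁ Xu
    ...     | (t′ , _ , Bw) ◅ path′ = spread Xu t′ Bw path′

    Z⊆X : Fin (2 + k) → Set
    Z⊆X i = ∀ {v} → Z i v → X v

    base : Z⊆X zero
    base z = map (λ (t , z₁ , z₂) → t , Z₀-avoids z₁ , Z₀-avoids z₂) (connZ zero b∈Z₀ z)

    Y-meets : ∀ i → ∃[ w ] Y i w × Separator w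
    Y-meets i with Z₀-Y i | Y-P i
    ... | _ , _ , z , y , t | _ , _ , y′ , p∈P , t′ with spread (base z) t y (connY i y y′)
    ...   | inj₁ Xy′ = ⊥-elim (avoids Xy′ p∈P t′)
    ...   | inj₂ r   = r

    next : ∀ i → Z⊆X (inject₁ i) → Z⊆X (suc i)
    next i Zᵢ⊆X z with Z-Z i
    ... | _ , _ , z₁ , z₂ , t with spread (Zᵢ⊆X z₁) t z₂ (connZ (suc i) z₂ z)
    ...   | inj₁ Xv = Xv
    ...   | inj₂ (w , Zw , Sw) =
      let u , Yu , Su = Y-meets i in ⊥-elim (Y¬Z i (u , w , Yu , Zw , separator-touch Su Sw))

-- Walks and their lengths

module _ {n} (G : SimpleGraph n) where

  private
    R : ℕ → Fin n → Fin n → Set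
    R = Reach (raw G)

  reach-mono : ∀ {j k u v} → j ≤ k → R j u v → R k u v
  reach-mono j≤k = go (≤⇒≤′ j≤k)
    where
    go : ∀ {j k u v} → j ≤′ k → R j u v → R k u v
    go ≤′-refl r = r
    go (≤′-step j≤k) r = inj₁ (go j≤k r)

  reach-refl : ∀ k {u} → R k u u
  reach-refl k = reach-mono {k = k} z≤n refl

  -- `Reach` grows at its far end, so recursion is on the second length, which therefore comes first
  -- in the sum. Later bounds such as `g y + (2 + f x)` follow this order.
  reach-++ : ∀ a b {u v w} → R a u v → R b v w → R (b + a) u w
  reach-++ a zero r refl = r
  reach-++ a (suc b) r (inj₁ q) = inj₁ (reach-++ a b r q)
  reach-++ a (suc b) r (inj₂ (x , q , e)) = inj₂ (x , reach-++ a b r q , e)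

  reach-split : ∀ a b {u w} → R (b + a) u w → ∃[ v ] R a u v × R b v w
  reach-split a zero r = _ , r , refl
  reach-split a (suc b) (inj₁ r) = let v , p , q = reach-split a b r in v , p , inj₁ q
  reach-split a (suc b) (inj₂ (x , r , e)) = let v , p , q = reach-split a b r in v , p , inj₂ (x , q , e)

  reach-sym : ∀ k {u v} → R k u v → R k v u
  reach-sym zero refl = refl
  reach-sym (suc k) (inj₁ r) = inj₁ (reach-sym k r)
  reach-sym (suc k) {u} {v} (inj₂ (w , r , e)) =
    subst (λ j → R j v u) (+-comm k 1) (reach-++ 1 k (inj₂ (_ , refl , adj-sym G e)) (reach-sym k r))

  -- Lowering valid functions to hull vertices

  module _ (adj? : ∀ u v → Dec (adj G u v)) where

    reach? : ∀ k u v → Dec (R k u v)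
    reach? zero u v = u ≟ v
    reach? (suc k) u v = reach? k u v ⊎-dec any? (λ w → reach? k u w ×-dec adj? w v)

    Valid : (Fin n → ℕ) → Set
    Valid h = ∀ x y → R (h x + h y) x y

    TightPair : (Fin n → ℕ) → Fin n → Fin n → Set
    TightPair h x y = IsDist (raw G) x y (h x + h y)

    Tight : (Fin n → ℕ) → Fin n → Set
    Tight h x = ∃ (TightPair h x)

    tight-bound : ∀ {h x y j} → TightPair h x y → R j x y → h x + h y ≤ j
    tight-bound (_ , min) r = ≮⇒≥ (λ j< → min _ j< r)

    -- Keeping tight vertices tight lets the vertices be treated one after another.
    Refines : (h h′ : Fin n → ℕ) → Set
    Refines h h′ = (∀ x → h′ x ≤ h x) × Valid h′ × (∀ y → Tight h y → Tight h′ y)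

    -- Lowering h x until x becomes tight keeps tight vertices tight: no constraint that is
    -- already an equality can be lowered.
    tighten : ∀ a x {h} → h x ≡ a → Valid h → ∃[ h′ ] Refines h h′ × Tight h′ x
    tighten zero x {h} hx≡0 valid =
      h , ((λ _ → ≤-refl) , valid , λ _ t → t) ,
      -- At value 0, `x` is tight with itself.
      x , subst (IsDist (raw G) x x) (sym (cong₂ _+_ hx≡0 hx≡0)) (refl , λ _ ())
    tighten (suc a) x {h} hx≡ valid with all? (λ y → reach? (a + h y) x y)
    ... | no ¬all =
      let y , ¬r = ¬∀⟶∃¬ n _ (λ y → reach? (a + h y) x y) ¬all in
      -- A `y` out of reach at `a + h y` is at distance exactly `suc a + h y`, so `x` is already
      -- tight.
      h , ((λ _ → ≤-refl) , valid , λ _ t → t) , y , valid x y ,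
      λ j j< r → ¬r (reach-mono (≤-pred (subst (λ k → j < k + h y) hx≡ j<)) r)
    ... | yes all =
      let h″ , (h″≤ , valid″ , keep″) , tight = tighten a x at valid′ in
      h″ , ((λ y → ≤-trans (h″≤ y) (h′≤h y)) , valid″ , λ y t → keep″ y (keep y t)) , tight
      where
      h′ : Fin n → ℕ
      h′ = updateAt h x pred

      at : h′ x ≡ a
      at = trans (updateAt-updates x h) (cong pred hx≡)

      off : ∀ {y} → y ≢ x → h′ y ≡ h y
      off y≢x = updateAt-minimal _ x h y≢x

      h′≤h : ∀ y → h′ y ≤ h y
      h′≤h y with y ≟ x
      ... | yes refl = ≤-trans (≤-reflexive (updateAt-updates x h)) pred[n]≤n
      ... | no y≢x   = ≤-reflexive (off y≢x)

      valid′ : Valid h′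
      valid′ y z with y ≟ x | z ≟ x
      ... | yes refl | yes refl = reach-refl (h′ x + h′ x)
      ... | yes refl | no z≢x   = subst (λ k → R k x z) (sym (cong₂ _+_ at (off z≢x))) (all z)
      ... | no y≢x   | yes refl =
        subst (λ k → R k y x) (trans (+-comm a (h y)) (sym (cong₂ _+_ (off y≢x) at))) (reach-sym (a + h y) (all y))
      ... | no y≢x   | no z≢x   = subst (λ k → R k y z) (sym (cong₂ _+_ (off y≢x) (off z≢x))) (valid y z)

      slack : ∀ z → ¬ TightPair h x z
      slack z t = 1+n≰n (subst (λ k → k + h z ≤ a + h z) hx≡ (tight-bound {h} t (all z)))

      keep : ∀ y → Tight h y → Tight h′ y
      keep y (z , t@(r , min)) with y ≟ x | z ≟ x
      ... | yes refl | _ = ⊥-elim (slack z t)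
      ... | no _ | yes refl =
        ⊥-elim (slack y (subst (IsDist (raw G) x y) (+-comm (h y) (h x)) (reach-sym (h y + h x) r , λ j j< r′ → min j j< (reach-sym j r′))))
      ... | no y≢x | no z≢x = z , subst (IsDist (raw G) y z) (sym (cong₂ _+_ (off y≢x) (off z≢x))) t

    tighten-all : ∀ xs {h} → Valid h → ∃[ h′ ] Refines h h′ × All (Tight h′) xs
    tighten-all [] {h} valid = h , ((λ _ → ≤-refl) , valid , λ _ t → t) , []
    tighten-all (x ∷ xs) {h} valid =
      let h′ , (h′≤ , valid′ , keep′) , tight′ = tighten (h x) x refl valid
          h″ , (h″≤ , valid″ , keep″) , tights = tighten-all xs valid′
      in h″ , ((λ y → ≤-trans (h″≤ y) (h′≤ y)) , valid″ , λ y t → keep″ y (keep′ y t)) , keep″ x tight′ ∷ tights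

    hull-below : ∀ {h} → Valid h → ∃[ h′ ] (∀ x → h′ x ≤ h x) × IsHullVertex G h′
    hull-below valid =
      let h′ , (h′≤ , valid′ , _) , tights = tighten-all (allFin n) valid in
      h′ , h′≤ , valid′ , λ x → All.lookup tights (∈-allFin x)

    -- Distance at most two in the hull

    -- For hull vertices this says that the sup-norm distance is at most 2.
    Near : (f g : Fin n → ℕ) → Set
    Near f g = ∀ x y → R (g y + (2 + f x)) x y

    -- Tightness of `f` gives the missing bound: if `y` is tight with `x`, then `f x + f y` is at
    -- most `h x + h y`, hence at most `h x + 1 + f y`.
    within-one : ∀ {f h} → IsHullVertex G f → Valid h → (∀ x → h x ≤ suc (f x)) → ∀ x → ∣ f x - h x ∣ ≤ 1
    within-one {f} {h} (_ , tight) valid h≤ x with ≤-total (f x) (h x)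
    ... | inj₁ f≤h = subst (_≤ 1) (sym (m≤n⇒∣m-n∣≡n∸m f≤h)) (m≤n+o⇒m∸n≤o _ (f x) (≤-trans (h≤ x) (≤-reflexive (+-comm 1 (f x)))))
    ... | inj₂ h≤f =
      let y , t = tight x
          fx≤ = +-cancelʳ-≤ (f y) (f x) (h x + 1) (begin
            f x + f y       ≤⟨ tight-bound {f} t (valid x y) ⟩
            h x + h y       ≤⟨ +-monoʳ-≤ (h x) (h≤ y) ⟩
            h x + (1 + f y) ≡⟨ +-assoc (h x) 1 (f y) ⟨
            h x + 1 + f y   ∎)
      in subst (_≤ 1) (sym (m≤n⇒∣n-m∣≡n∸m h≤f)) (m≤n+o⇒m∸n≤o _ (h x) fx≤)
      where open ≤-Reasoning

    -- Adjacency in the hull requires a difference of exactly 1 somewhere, so when `w` and `g` agree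
    -- pointwise the walk to `w` is transported to `g` instead.
    close⇒reach : ∀ (f g : V (Hull G)) k (w : V (Hull G)) → Reach (Hull G) k f w →
                  (∀ x → ∣ proj₁ w x - proj₁ g x ∣ ≤ 1) → Reach (Hull G) (suc k) f g
    close⇒reach f g k w r close with all? (λ x → proj₁ w x ≟ℕ proj₁ g x)
    ... | yes w≈g = inj₁ (reach-resp k r w≈g)
      where
      reach-resp : ∀ k → Reach (Hull G) k f w → (∀ x → proj₁ w x ≡ proj₁ g x) → Reach (Hull G) k f g
      reach-resp zero r e x = trans (r x) (e x)
      reach-resp (suc k) (inj₁ r) e = inj₁ (reach-resp k r e)
      reach-resp (suc k) (inj₂ (v , r , le , x , eq)) e =
        inj₂ (v , r , (λ x → subst (λ b → ∣ proj₁ v x - b ∣ ≤ 1) (e x) (le x)) ,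
          x , trans (cong (λ b → ∣ proj₁ v x - b ∣) (sym (e x))) eq)
    ... | no ¬≈ =
      let x , w≢g = ¬∀⟶∃¬ n _ (λ x → proj₁ w x ≟ℕ proj₁ g x) ¬≈ in
      inj₂ (w , r , close , x , ≤-antisym (close x) (n≢0⇒n>0 (λ e → w≢g (∣m-n∣≡0⇒m≡n e))))

    near⇒reach : ∀ {f g} → Near (proj₁ f) (proj₁ g) → Reach (Hull G) 2 f g
    near⇒reach {f , hf} {g , hg} near =
      let h , h≤ , hh = hull-below valid
          h≤f = λ x → ≤-trans (h≤ x) (s≤s (m⊓n≤m (f x) (g x)))
          h≤g = λ x → ≤-trans (h≤ x) (s≤s (m⊓n≤n (f x) (g x)))
          f-h = within-one hf (proj₁ hh) h≤f
          h-g = λ x → subst (_≤ 1) (∣-∣-comm (g x) (h x)) (within-one hg (proj₁ hh) h≤g x)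
      in close⇒reach (f , hf) (g , hg) 1 (h , hh) (close⇒reach (f , hf) (h , hh) 0 (f , hf) (λ _ → refl) f-h) h-g
      where
      shift : ∀ a b → 2 + (a + b) ≡ suc a + suc b
      shift a b = cong suc (sym (+-suc a b))

      swap : ∀ a b → b + (2 + a) ≡ suc a + suc b
      swap a b = trans (+-comm b (2 + a)) (shift a b)

      -- If both minima come from the same function, its own validity leaves a slack of 2; mixed
      -- pairs are exactly what `Near` provides.
      valid : Valid (λ x → suc (f x ⊓ g x))
      valid x y with ⊓-sel (f x) (g x) | ⊓-sel (f y) (g y)
      ... | inj₁ p | inj₁ q rewrite p | q = subst (λ k → R k x y) (shift (f x) (f y)) (inj₁ (inj₁ (proj₁ hf x y)))
      ... | inj₁ p | inj₂ q rewrite p | q = subst (λ k → R k x y) (swap (f x) (g y)) (near x y)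
      ... | inj₂ p | inj₁ q rewrite p | q =
        subst (λ k → R k x y) (trans (swap (f y) (g x)) (+-comm (suc (f y)) (suc (g x)))) (reach-sym (g x + (2 + f y)) (near y x))
      ... | inj₂ p | inj₂ q rewrite p | q = subst (λ k → R k x y) (shift (g x) (g y)) (inj₁ (inj₁ (proj₁ hg x y)))

    reach⇒≤ : ∀ k {f g} → Reach (Hull G) k f g → ∀ x → proj₁ f x ≤ proj₁ g x + k
    reach⇒≤ zero r x = ≤-trans (≤-reflexive (r x)) (m≤m+n _ 0)
    reach⇒≤ (suc k) {f} {g} (inj₁ r) x = ≤-trans (reach⇒≤ k {f} {g} r x) (+-monoʳ-≤ _ (n≤1+n k))
    reach⇒≤ (suc k) {f , _} {g , _} (inj₂ ((w , hw) , r , close , _)) x = begin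
      f x                       ≤⟨ reach⇒≤ k r x ⟩
      w x + k                   ≤⟨ +-monoˡ-≤ k (m≤n+∣m-n∣ (w x) (g x)) ⟩
      g x + ∣ w x - g x ∣ + k   ≤⟨ +-monoˡ-≤ k (+-monoʳ-≤ (g x) (close x)) ⟩
      g x + 1 + k               ≡⟨ +-assoc (g x) 1 k ⟩
      g x + suc k               ∎
      where open ≤-Reasoning

    reach⇒near : ∀ {f g} → Reach (Hull G) 2 f g → Near (proj₁ f) (proj₁ g)
    reach⇒near {f , hf} {g , hg} r x y = reach-mono (begin
      f x + f y         ≡⟨ +-comm (f x) (f y) ⟩
      f y + f x         ≤⟨ +-monoˡ-≤ (f x) (reach⇒≤ 2 {f , hf} {g , hg} r y) ⟩
      g y + 2 + f x     ≡⟨ +-assoc (g y) 2 (f x) ⟩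
      g y + (2 + f x)   ∎) (proj₁ hf x y)
      where open ≤-Reasoning

    far : ∀ {f g} → ¬ Reach (Hull G) 2 f g → ∃[ x ] ∃[ y ] ¬ R (proj₁ g y + (2 + proj₁ f x)) x y
    far {f} {g} ¬r =
      let near? = λ x y → reach? (proj₁ g y + (2 + proj₁ f x)) x y
          x , ¬x = ¬∀⟶∃¬ n _ (λ x → all? (near? x)) (λ near → ¬r (near⇒reach {f} {g} near)) in
      x , ¬∀⟶∃¬ n _ (near? x) ¬x

    -- Disks as connected sets of the squared graph

    open Touching _≟_ (R 2) (reach? 2) (reach-refl 2) (reach-sym 2)

    Ball : Fin n → ℕ → Fin n → Set
    Ball x r v = R r x v

    -- A walk of length at most `r` from the centre never leaves the disk, and each of its edges is
    -- a touching pair.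
    ball-to-centre : ∀ {x v r} s → s ≤ r → R s x v → Star (Within (Ball x r)) v x
    ball-to-centre zero _ refl = ε
    ball-to-centre (suc s) s<r (inj₁ q) = ball-to-centre s (<⇒≤ s<r) q
    ball-to-centre (suc s) s<r p@(inj₂ (w , q , e)) =
      (inj₁ (inj₂ (_ , refl , adj-sym G e)) , reach-mono s<r p , reach-mono (<⇒≤ s<r) q) ◅
      ball-to-centre s (<⇒≤ s<r) q

    ball-connected : ∀ x r → ConnectedSet (Ball x r)
    ball-connected x r p q =
      ball-to-centre r ≤-refl p ◅◅ within-sym {Q = Ball x r} (ball-to-centre r ≤-refl q)

    -- Cutting the walk into lengths `r`, 2 and `s` yields a touching pair, one vertex in each disk.
    reach⇒touches : ∀ x y r s → R (s + (2 + r)) x y → Touches (Ball x r) (Ball y s)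
    reach⇒touches x y r s p =
      let v , p′ , q = reach-split (2 + r) s p
          u , p″ , t = reach-split r 2 p′
      in u , v , p″ , reach-sym s q , t

    touches⇒reach : ∀ x y r s → Touches (Ball x r) (Ball y s) → R (s + (2 + r)) x y
    touches⇒reach x y r s (u , v , p , q , t) = reach-++ (2 + r) s (reach-++ r 2 p t) (reach-sym s q)

    -- Disks along an induced cycle of the squared hull

    hull-square-chordal : SquareChordal (raw G) → SquareChordal (Hull G)
    hull-square-chordal chordal _ (s≤s (s≤s (s≤s (s≤s (z≤n {k}))))) c (distinct , adjacent , nonadjacent) =
      no-touching-chain chordal {P = P} {Y = Y} {Z = Z}
        (λ v → any? (λ p → reach? (f zero a) a p ×-dec reach? 2 v p))
        (D-connected zero a) (λ i → D-connected (suc zero) _) (λ i → D-connected (suc (suc i)) _)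
        (λ t → a-b (touching⇒near zero (suc (suc zero)) a b (touches-sym {Z zero} {P} t)))
        (λ i → touching (inj₂ (inj₁ refl)) _ _)
        (λ i → touching (inj₂ (inj₁ refl)) _ _)
        (λ i t → proj₂ (proj₂ (apart i)) (touching⇒near (suc zero) (suc (suc (suc i))) _ _ t))
        (λ i → touching (inj₁ (cong (3 +_) (toℕ-inject₁ i))) _ _)
        -- The edge closing the cycle, from its last vertex back to the first, is what the chain
        -- excludes.
        (touching (inj₂ (inj₂ (inj₂ (refl , cong (4 +_) (toℕ-fromℕ k))))) _ _)
      where
      f : Fin (4 + k) → Fin n → ℕ
      f j = proj₁ (c j)

      D : Fin (4 + k) → Fin n → Fin n → Set
      D j x = Ball x (f j x)

      separated : ∀ i j → i ≢ j → ¬ CycNbr (4 + k) i j → ∃[ x ] ∃[ y ] ¬ R (f j y + (2 + f i x)) x y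
      separated i j i≢j ¬nb =
        far {c i} {c j} (λ r → nonadjacent i j i≢j ¬nb (distinct i j i≢j , r))

      touching : ∀ {i j} → CycNbr (4 + k) i j → ∀ x y → Touches (D i x) (D j y)
      touching {i} {j} nb x y = reach⇒touches x y (f i x) (f j y) (reach⇒near {c i} {c j} (proj₂ (adjacent i j nb)) x y)

      touching⇒near : ∀ i j x y → Touches (D i x) (D j y) → R (f j y + (2 + f i x)) x y
      touching⇒near i j x y = touches⇒reach x y (f i x) (f j y)

      D-connected : ∀ j x → ConnectedSet (D j x)
      D-connected j x = ball-connected x (f j x)

      ends : ∃[ x ] ∃[ y ] ¬ R (f (suc (suc zero)) y + (2 + f zero x)) x y
      ends = separated zero (suc (suc zero)) (λ ())
        λ { (inj₁ ()) ; (inj₂ (inj₁ ())) ; (inj₂ (inj₂ (inj₁ (_ , ())))) ; (inj₂ (inj₂ (inj₂ (() , _)))) }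

      a b : Fin n
      a = proj₁ ends
      b = proj₁ (proj₂ ends)

      a-b : ¬ R (f (suc (suc zero)) b + (2 + f zero a)) a b
      a-b = proj₂ (proj₂ ends)

      P : Fin n → Set
      P = D zero a

      apart : (i : Fin (1 + k)) → ∃[ x ] ∃[ y ] ¬ R (f (suc (suc (suc i))) y + (2 + f (suc zero) x)) x y
      apart i = separated (suc zero) (suc (suc (suc i))) (λ ())
        λ { (inj₁ ()) ; (inj₂ (inj₁ ())) ; (inj₂ (inj₂ (inj₁ (() , _)))) ; (inj₂ (inj₂ (inj₂ (() , _)))) }

      Y : Fin (1 + k) → Fin n → Set
      Y i = D (suc zero) (proj₁ (apart i))

      -- The disk at `b` misses `P`; each later vertex contributes the disk that `Y i` misses.
      centre : Fin (2 + k) → Fin n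
      centre zero    = b
      centre (suc i) = proj₁ (proj₂ (apart i))

      Z : Fin (2 + k) → Fin n → Set
      Z i = D (suc (suc i)) (centre i)

theorem4 : ∀ {n : ℕ} (G : SimpleGraph n) → Connected G
    → SquareChordal (raw G) → SquareChordal (Hull G)
-- Adjacency is not assumed decidable, but the goal is a negation and there are finitely many pairs.
theorem4 G _ chordal m 4≤m c cycle =
  sequence rawApplicative (λ u → sequence rawApplicative (λ v → ¬¬-excluded-middle))
    (λ adj? → hull-square-chordal G adj? chordal m 4≤m c cycle)
  where open RawMonad ¬¬-Monad using (rawApplicative)
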